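{- Let $0\le q_1\le n_1$ and $0\le q_2\le n_2$ be integers and let $\{x_i\}_{i=q_1}^{n_1}$ and $\{y_i\}_{i=q_2}^{n_2}$ be unimodal sequences of nonnegative numbers. Let $l_1,l_1+1,\dots,m_1$ be the modes of $\{x_i\}$ and $l_2,l_2+1,\dots,m_2$ be the modes of $\{y_i\}$ (with $l_1\le m_1$, $l_2\le m_2$). Let $r_1,r_2$ be non-negative integers and let $a_1,a_2>0$. Then the sequence $\{a_1x_{i-r_1}+a_2y_{i-r_2}\}_i$ is unimodal if and only if its restriction to the indices $i$ with $\min\{l_1+r_1,\,l_2+r_2\}\le i\le \max\{m_1+r_1,\,m_2+r_2\}$ is unimodal.
   Context: A finite sequence of nonnegative numbers $\{a_i\}_{i=q}^{n}$ ($0\le q\le n$) is unimodal if there are indices $q\le l\le m\le n$ with $a_q\le a_{q+1}\le\cdots\le a_{l-1}<a_l=\cdots=a_m>a_{m+1}\ge\cdots\ge a_n$ (inequalities involving indices outside $[q,n]$ are omitted). The indices $l,l+1,\dots,m$ are called the modes of the sequence. Terms $x_i$, $y_i$ with index outside the given ranges are taken to be $0$, and the combined sequence $\{a_1x_{i-r_1}+a_2y_{i-r_2}\}$ is indexed by $\min_{j=1,2}\{q_j+r_j\}\le i\le \max_{j=1,2}\{n_j+r_j\}$. -}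

module Defs where

open import Level using (Level; _⊔_; suc)
open import Algebra.Core using (Op₁; Op₂)
open import Algebra.Structures using (IsCommutativeRing)
open import Data.Bool.Base using (if_then_else_)
open import Data.Integer.Base using (ℤ; +_; -[1+_])
open import Data.Nat.Base as ℕ using (ℕ)
open import Data.Nat.Properties as ℕ using ()
open import Data.Product.Base using (∃-syntax; _×_)
open import Relation.Binary.Core using (Rel)
open import Relation.Binary.PropositionalEquality.Core using (_≡_)
open import Relation.Binary.Structures using (IsStrictTotalOrder)
import Relation.Binary.Construct.StrictToNonStrict as StrictToNonStrict
open import Relation.Nullary.Decidable using (⌊_⌋; _×-dec_)
open import Relation.Nullary.Negation.Core using (¬_)

-- The standard library has neither real numbers nor ordered fields. The
-- scalars are therefore an arbitrary totally ordered field, with trichotomy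
-- as part of the structure; classically ℝ is an instance.
record OrderedField c ℓ₁ ℓ₂ : Set (suc (c ⊔ ℓ₁ ⊔ ℓ₂)) where
  infix  8 -_
  infixl 7 _*_
  infixl 6 _+_
  infix  4 _≈_ _<_ _≤_
  field
    Carrier            : Set c
    _≈_                : Rel Carrier ℓ₁
    _<_                : Rel Carrier ℓ₂
    _+_                : Op₂ Carrier
    _*_                : Op₂ Carrier
    -_                 : Op₁ Carrier
    0#                 : Carrier
    1#                 : Carrier
    isCommutativeRing  : IsCommutativeRing _≈_ _+_ _*_ -_ 0# 1#
    isStrictTotalOrder : IsStrictTotalOrder _≈_ _<_
    0<1                : 0# < 1#
    inverse            : ∀ x → ¬ (x ≈ 0#) → ∃[ y ] x * y ≈ 1#
    +-monoʳ-<          : ∀ x {y z} → y < z → x + y < x + z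
    *-pos              : ∀ {x y} → 0# < x → 0# < y → 0# < x * y

  _≤_ : Rel Carrier (ℓ₁ ⊔ ℓ₂)
  _≤_ = StrictToNonStrict._≤_ _≈_ _<_

-- A finite sequence {aᵢ} with q ≤ i ≤ n is given by the bounds q, n and a
-- function a : ℕ → Carrier whose values outside [q , n] are irrelevant.
-- Restricting a sequence to fewer indices thus only changes the bounds.
module _ {c ℓ₁ ℓ₂ : Level} (K : OrderedField c ℓ₁ ℓ₂) where
  open OrderedField K

  NonNegative : (q n : ℕ) → (ℕ → Carrier) → Set (ℓ₁ ⊔ ℓ₂)
  NonNegative q n a = ∀ i → q ℕ.≤ i → i ℕ.≤ n → 0# ≤ a i

  -- a q ≤ ⋯ ≤ a (l - 1) < a l = ⋯ = a m > a (m + 1) ≥ ⋯ ≥ a n, where each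
  -- inequality is required only if both of its indices lie in [q , n].
  record HasModes (q n : ℕ) (a : ℕ → Carrier) (l m : ℕ) : Set (ℓ₁ ⊔ ℓ₂) where
    field
      q≤l        : q ℕ.≤ l
      l≤m        : l ℕ.≤ m
      m≤n        : m ℕ.≤ n
      increasing : ∀ i → q ℕ.≤ i → ℕ.suc i ℕ.< l → a i ≤ a (ℕ.suc i)
      jump       : ∀ i → q ℕ.≤ i → ℕ.suc i ≡ l → a i < a l
      constant   : ∀ i → l ℕ.≤ i → i ℕ.≤ m → a i ≈ a l
      drop       : ℕ.suc m ℕ.≤ n → a (ℕ.suc m) < a m
      decreasing : ∀ i → m ℕ.< i → ℕ.suc i ℕ.≤ n → a (ℕ.suc i) ≤ a i

  Unimodal : (q n : ℕ) → (ℕ → Carrier) → Set (ℓ₁ ⊔ ℓ₂)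
  Unimodal q n a = ∃[ l ] ∃[ m ] HasModes q n a l m

  zeroExtend : (q n : ℕ) → (ℕ → Carrier) → ℤ → Carrier
  zeroExtend q n a (+ i)    =
    if ⌊ (q ℕ.≤? i) ×-dec (i ℕ.≤? n) ⌋ then a i else 0#
  zeroExtend q n a -[1+ _ ] = 0#

{-# OPTIONS --safe #-}

-- A sequence is unimodal iff it is nondecreasing up to some peak and
-- nonincreasing from there on. In this form unimodality passes to subintervals,
-- and it passes back to a larger interval when the sequence is nondecreasing
-- before the subinterval and nonincreasing after it. A nonnegative unimodal
-- sequence stays nondecreasing before its modes and nonincreasing after them
-- when it is extended by 0, so a positive combination of two such sequences is
-- nondecreasing before the modes of both and nonincreasing after them.
module Submission where

open import Defs
import Level
open import Algebra.Bundles using (CommutativeRing)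
open import Data.Empty using (⊥-elim)
open import Data.Integer.Base using (+_; -[1+_]; _⊖_)
open import Data.Integer.Properties using ([1+m]⊖[1+n]≡m⊖n)
open import Data.Nat.Base as ℕ using (ℕ; _⊓_; _⊔_; _≤′_; ≤′-refl; ≤′-step; _≤‴_; ≤‴-refl; ≤‴-step)
open import Data.Nat.Properties as ℕ using ()
open import Data.Product.Base using (∃-syntax; _×_; _,_)
open import Data.Sum.Base using (inj₁; inj₂)
open import Function.Bundles using (_⇔_; mk⇔)
open import Relation.Binary.PropositionalEquality.Core as ≡ using (_≡_; subst; subst₂)
open import Relation.Binary.Structures using (IsStrictTotalOrder)
import Relation.Binary.Construct.StrictToNonStrict as StrictToNonStrict
open import Relation.Nullary.Decidable using (yes; no; _×-dec_)
open import Relation.Nullary.Negation.Core using (¬_)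

module _ {c ℓ₁ ℓ₂} (K : OrderedField c ℓ₁ ℓ₂) where
  open OrderedField K

  -- Order arithmetic in an ordered field

  commutativeRing : CommutativeRing c ℓ₁
  commutativeRing = record { isCommutativeRing = isCommutativeRing }

  open CommutativeRing commutativeRing
    using (isEquivalence; refl; sym; trans; +-cong; +-comm; +-assoc;
           +-identityˡ; +-identityʳ; -‿inverseˡ; -‿inverseʳ; *-congˡ; distribˡ)
  open IsStrictTotalOrder isStrictTotalOrder
    using (<-resp-≈; <-respʳ-≈; <-respˡ-≈)
    renaming (trans to <-trans)

  ≤-reflexive : ∀ {u v} → u ≈ v → u ≤ v
  ≤-reflexive = inj₂

  ≤-trans : ∀ {u v w} → u ≤ v → v ≤ w → u ≤ w
  ≤-trans = StrictToNonStrict.trans _≈_ _<_ isEquivalence <-resp-≈ <-trans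

  +-monoʳ-≤ : ∀ u {v w} → v ≤ w → u + v ≤ u + w
  +-monoʳ-≤ u (inj₁ v<w) = inj₁ (+-monoʳ-< u v<w)
  +-monoʳ-≤ u (inj₂ v≈w) = inj₂ (+-cong refl v≈w)

  +-mono-≤ : ∀ {u v w t} → u ≤ v → w ≤ t → u + w ≤ v + t
  +-mono-≤ {u} {v} {w} {t} u≤v w≤t =
    ≤-trans (+-monoʳ-≤ u w≤t)
      (≤-trans (≤-reflexive (+-comm u t))
        (≤-trans (+-monoʳ-≤ t u≤v) (≤-reflexive (+-comm t v))))

  -- The axioms only make products of positive elements positive, so the positive difference
  -- `- u + v` is multiplied by `a` and then added to `a * u`.
  *-monoʳ-< : ∀ {a u v} → 0# < a → u < v → a * u < a * v
  *-monoʳ-< {a} {u} {v} 0<a u<v =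
    <-respˡ-≈ (+-identityʳ (a * u))
      (<-respʳ-≈ au+ad≈av (+-monoʳ-< (a * u) (*-pos 0<a 0<v-u)))
    where
    0<v-u : 0# < - u + v
    0<v-u = <-respˡ-≈ (-‿inverseˡ u) (+-monoʳ-< (- u) u<v)

    au+ad≈av : a * u + a * (- u + v) ≈ a * v
    au+ad≈av =
      trans (sym (distribˡ a u (- u + v)))
        (*-congˡ (trans (sym (+-assoc u (- u) v))
          (trans (+-cong (-‿inverseʳ u) refl) (+-identityˡ v))))

  *-monoʳ-≤ : ∀ {a u v} → 0# < a → u ≤ v → a * u ≤ a * v
  *-monoʳ-≤ 0<a (inj₁ u<v) = inj₁ (*-monoʳ-< 0<a u<v)
  *-monoʳ-≤ 0<a (inj₂ u≈v) = inj₂ (*-congˡ u≈v)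

  -- Unimodality as the existence of a peak

  Nondecreasing : (q n : ℕ) → (ℕ → Carrier) → Set _
  Nondecreasing q n a = ∀ i → q ℕ.≤ i → i ℕ.< n → a i ≤ a (ℕ.suc i)

  Nonincreasing : (q n : ℕ) → (ℕ → Carrier) → Set _
  Nonincreasing q n a = ∀ i → q ℕ.≤ i → i ℕ.< n → a (ℕ.suc i) ≤ a i

  -- Only weak inequalities occur, so a peak is not unique: any mode can serve as `p`.
  record HasPeak (q n : ℕ) (a : ℕ → Carrier) (p : ℕ) : Set (ℓ₁ Level.⊔ ℓ₂) where
    constructor peak
    field
      q≤p  : q ℕ.≤ p
      p≤n  : p ℕ.≤ n
      rise : Nondecreasing q p a
      fall : Nonincreasing p n a

  rise-to-mode : ∀ {q n a l m} → HasModes K q n a l m → Nondecreasing q l a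
  rise-to-mode modes i q≤i i<l with ℕ.m≤n⇒m<n∨m≡n i<l
  ... | inj₁ 1+i<l  = HasModes.increasing modes i q≤i 1+i<l
  ... | inj₂ ≡.refl = inj₁ (HasModes.jump modes i q≤i ≡.refl)

  fall-from-last-mode : ∀ {q n a l m} → HasModes K q n a l m → Nonincreasing m n a
  fall-from-last-mode modes i m≤i i<n with ℕ.m≤n⇒m<n∨m≡n m≤i
  ... | inj₁ m<i    = HasModes.decreasing modes i m<i i<n
  ... | inj₂ ≡.refl = inj₁ (HasModes.drop modes i<n)

  -- With the first mode as peak, the fall begins with the plateau up to `m`, where the weak
  -- inequality holds because both terms equal `a l`.
  modes⇒peak : ∀ {q n a l m} → HasModes K q n a l m → HasPeak q n a l
  modes⇒peak {q} {n} {a} {l} {m} modes =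
    peak q≤l (ℕ.≤-trans l≤m m≤n) (rise-to-mode modes) fall
    where
    open HasModes modes
    fall : Nonincreasing l n a
    fall i l≤i i<n with i ℕ.<? m
    ... | yes i<m = inj₂ (trans (constant (ℕ.suc i) (ℕ.m≤n⇒m≤1+n l≤i) i<m)
                                (sym (constant i l≤i (ℕ.<⇒≤ i<m))))
    ... | no  i≮m = fall-from-last-mode modes i (ℕ.≮⇒≥ i≮m) i<n

  -- Finds the left end of the plateau through `p`. Recursion on `≤′` lowers `p` with `q` fixed: a
  -- strict last step makes the top index the first mode, while an equality lets the plateau
  -- continue to the left.
  first-mode : ∀ {q p a} → q ≤′ p → Nondecreasing q p a →
    ∃[ l ] q ℕ.≤ l × l ℕ.≤ p × (∀ i → l ℕ.≤ i → i ℕ.≤ p → a i ≈ a p)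
      × (∀ i → q ℕ.≤ i → ℕ.suc i ≡ l → a i < a l)
  first-mode {q} {a = a} ≤′-refl rise =
    q , ℕ.≤-refl , ℕ.≤-refl ,
    (λ i q≤i i≤q → subst (λ j → a i ≈ a j) (ℕ.≤-antisym i≤q q≤i) refl) ,
    λ i q≤i 1+i≡q → ⊥-elim (ℕ.<⇒≱ (ℕ.≤-reflexive 1+i≡q) q≤i)
  first-mode {q} {ℕ.suc p} {a} (≤′-step q≤′p) rise
    with rise p (ℕ.≤′⇒≤ q≤′p) ℕ.≤-refl
  ... | inj₁ ap<ap+1 =
    ℕ.suc p , ℕ.m≤n⇒m≤1+n (ℕ.≤′⇒≤ q≤′p) , ℕ.≤-refl ,
    (λ i p<i i≤1+p → subst (λ j → a i ≈ a j) (ℕ.≤-antisym i≤1+p p<i) refl) ,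
    λ { _ _ ≡.refl → ap<ap+1 }
  ... | inj₂ ap≈ap+1
    with l , q≤l , l≤p , constant , jump ←
           first-mode q≤′p (λ i q≤i i<p → rise i q≤i (ℕ.m<n⇒m<1+n i<p)) =
    l , q≤l , ℕ.m≤n⇒m≤1+n l≤p , constant′ , jump
    where
    constant′ : ∀ i → l ℕ.≤ i → i ℕ.≤ ℕ.suc p → a i ≈ a (ℕ.suc p)
    constant′ i l≤i i≤1+p with ℕ.m≤n⇒m<n∨m≡n i≤1+p
    ... | inj₁ i<1+p  = trans (constant i l≤i (ℕ.≤-pred i<1+p)) ap≈ap+1
    ... | inj₂ ≡.refl = refl

  -- Mirror image of `first-mode`. Here `≤‴` is the fitting order, since the recursion must raise
  -- `p` with `n` fixed.
  last-mode : ∀ {p n a} → p ≤‴ n → Nonincreasing p n a →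
    ∃[ m ] p ℕ.≤ m × m ℕ.≤ n × (∀ i → p ℕ.≤ i → i ℕ.≤ m → a i ≈ a p)
      × (m ℕ.< n → a (ℕ.suc m) < a m)
  last-mode {p} {a = a} ≤‴-refl fall =
    p , ℕ.≤-refl , ℕ.≤-refl ,
    (λ i p≤i i≤p → subst (λ j → a i ≈ a j) (ℕ.≤-antisym i≤p p≤i) refl) ,
    λ p<p → ⊥-elim (ℕ.<-irrefl ≡.refl p<p)
  last-mode {p} {n} {a} (≤‴-step p<‴n) fall with fall p ℕ.≤-refl (ℕ.≤‴⇒≤ p<‴n)
  ... | inj₁ ap+1<ap =
    p , ℕ.≤-refl , ℕ.<⇒≤ (ℕ.≤‴⇒≤ p<‴n) ,
    (λ i p≤i i≤p → subst (λ j → a i ≈ a j) (ℕ.≤-antisym i≤p p≤i) refl) ,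
    λ _ → ap+1<ap
  ... | inj₂ ap+1≈ap
    with m , p<m , m≤n , constant , drop ←
           last-mode p<‴n (λ i p<i i<n → fall i (ℕ.<⇒≤ p<i) i<n) =
    m , ℕ.<⇒≤ p<m , m≤n , constant′ , drop
    where
    constant′ : ∀ i → p ℕ.≤ i → i ℕ.≤ m → a i ≈ a p
    constant′ i p≤i i≤m with ℕ.m≤n⇒m<n∨m≡n p≤i
    ... | inj₁ p<i    = trans (constant i p<i i≤m) ap+1≈ap
    ... | inj₂ ≡.refl = refl

  -- The modes are the two half-plateaus on either side of `p`, glued at `p`.
  peak⇒unimodal : ∀ {q n a p} → HasPeak q n a p → Unimodal K q n a
  peak⇒unimodal {q} {n} {a} {p} (peak q≤p p≤n rise fall)
    with l , q≤l , l≤p , constantˡ , jump ← first-mode (ℕ.≤⇒≤′ q≤p) rise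
       | m , p≤m , m≤n , constantʳ , drop ← last-mode (ℕ.≤⇒≤‴ p≤n) fall =
    l , m , record
      { q≤l        = q≤l
      ; l≤m        = ℕ.≤-trans l≤p p≤m
      ; m≤n        = m≤n
      ; increasing = λ i q≤i 1+i<l → rise i q≤i (ℕ.<⇒≤ (ℕ.<-≤-trans 1+i<l l≤p))
      ; jump       = jump
      -- Both half-plateaus are compared with `a p`, but the field asks for `a l`; since `l` lies on
      -- the left half, `a l` equals `a p`.
      ; constant   = λ i l≤i i≤m →
          trans (constant-p i l≤i i≤m) (sym (constantˡ l ℕ.≤-refl l≤p))
      ; drop       = drop
      ; decreasing = λ i m<i i<n → fall i (ℕ.≤-trans p≤m (ℕ.<⇒≤ m<i)) i<n
      }
    where
    constant-p : ∀ i → l ℕ.≤ i → i ℕ.≤ m → a i ≈ a p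
    constant-p i l≤i i≤m with ℕ.≤-total i p
    ... | inj₁ i≤p = constantˡ i l≤i i≤p
    ... | inj₂ p≤i = constantʳ i p≤i i≤m

  -- The new peak is `p` clamped to the smaller interval: if `p` lies to one side, the sequence is
  -- monotone on the whole subinterval and the endpoint nearest to `p` is a peak.
  restrict : ∀ {q n q′ n′ a p} → q ℕ.≤ q′ → q′ ℕ.≤ n′ → n′ ℕ.≤ n →
    HasPeak q n a p → ∃[ p′ ] HasPeak q′ n′ a p′
  restrict {q′ = q′} {n′} {p = p} q≤q′ q′≤n′ n′≤n (peak q≤p p≤n rise fall)
    with ℕ.≤-total p q′ | ℕ.≤-total p n′
  ... | inj₁ p≤q′ | _ =
    q′ , peak ℕ.≤-refl q′≤n′
      (λ i q′≤i i<q′ → ⊥-elim (ℕ.<⇒≱ i<q′ q′≤i))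
      (λ i q′≤i i<n′ → fall i (ℕ.≤-trans p≤q′ q′≤i) (ℕ.<-≤-trans i<n′ n′≤n))
  ... | inj₂ q′≤p | inj₁ p≤n′ =
    p , peak q′≤p p≤n′
      (λ i q′≤i i<p → rise i (ℕ.≤-trans q≤q′ q′≤i) i<p)
      (λ i p≤i i<n′ → fall i p≤i (ℕ.<-≤-trans i<n′ n′≤n))
  ... | inj₂ q′≤p | inj₂ n′≤p =
    n′ , peak q′≤n′ ℕ.≤-refl
      (λ i q′≤i i<n′ → rise i (ℕ.≤-trans q≤q′ q′≤i) (ℕ.<-≤-trans i<n′ n′≤p))
      (λ i n′≤i i<n′ → ⊥-elim (ℕ.<⇒≱ i<n′ n′≤i))

  -- The peak stays the same: the indices added on the left all precede `p`, and those added on the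
  -- right all follow it.
  extend : ∀ {q n q′ n′ a p} → q ℕ.≤ q′ → n′ ℕ.≤ n →
    Nondecreasing q q′ a → Nonincreasing n′ n a →
    HasPeak q′ n′ a p → HasPeak q n a p
  extend {q} {n} {q′} {n′} {a} {p} q≤q′ n′≤n before after (peak q′≤p p≤n′ rise fall) =
    peak (ℕ.≤-trans q≤q′ q′≤p) (ℕ.≤-trans p≤n′ n′≤n) rise′ fall′
    where
    rise′ : Nondecreasing q p a
    rise′ i q≤i i<p with i ℕ.<? q′
    ... | yes i<q′ = before i q≤i i<q′
    ... | no  i≮q′ = rise i (ℕ.≮⇒≥ i≮q′) i<p

    fall′ : Nonincreasing p n a
    fall′ i p≤i i<n with i ℕ.<? n′
    ... | yes i<n′ = fall i p≤i i<n′
    ... | no  i≮n′ = after i (ℕ.≮⇒≥ i≮n′) i<n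

  unimodal-⇔ : ∀ {q n q′ n′ a} → q ℕ.≤ q′ → q′ ℕ.≤ n′ → n′ ℕ.≤ n →
    Nondecreasing q q′ a → Nonincreasing n′ n a →
    Unimodal K q n a ⇔ Unimodal K q′ n′ a
  unimodal-⇔ q≤q′ q′≤n′ n′≤n before after = mk⇔
    (λ (_ , _ , modes) →
      let _ , pk = restrict q≤q′ q′≤n′ n′≤n (modes⇒peak modes) in peak⇒unimodal pk)
    (λ (_ , _ , modes) →
      peak⇒unimodal (extend q≤q′ n′≤n before after (modes⇒peak modes)))

  -- Sequences extended by zero and shifted

  module _ {q n : ℕ} {a : ℕ → Carrier} where

    zeroExtend-inside : ∀ {i} → q ℕ.≤ i → i ℕ.≤ n → zeroExtend K q n a (+ i) ≡ a i
    zeroExtend-inside {i} q≤i i≤n with (q ℕ.≤? i) ×-dec (i ℕ.≤? n)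
    ... | yes _       = ≡.refl
    ... | no  outside = ⊥-elim (outside (q≤i , i≤n))

    zeroExtend-outside : ∀ {i} → ¬ (q ℕ.≤ i × i ℕ.≤ n) → zeroExtend K q n a (+ i) ≡ 0#
    zeroExtend-outside {i} outside with (q ℕ.≤? i) ×-dec (i ℕ.≤? n)
    ... | yes inside = ⊥-elim (outside inside)
    ... | no  _      = ≡.refl

    zeroExtend-nonNegative : NonNegative K q n a → ∀ k → 0# ≤ zeroExtend K q n a k
    zeroExtend-nonNegative 0≤a -[1+ _ ] = inj₂ refl
    zeroExtend-nonNegative 0≤a (+ i) with (q ℕ.≤? i) ×-dec (i ℕ.≤? n)
    ... | yes (q≤i , i≤n) = 0≤a i q≤i i≤n
    ... | no  _           = inj₂ refl

    module _ {l m} (0≤a : NonNegative K q n a) (modes : HasModes K q n a l m) where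
      open HasModes modes

      -- Below `q` the left term is 0, so nonnegativity suffices; this includes the step from
      -- `q - 1` into the sequence.
      zeroExtend-rise : ∀ i → i ℕ.< l →
        zeroExtend K q n a (+ i) ≤ zeroExtend K q n a (+ ℕ.suc i)
      zeroExtend-rise i i<l with ℕ.≤-<-connex q i
      ... | inj₁ q≤i = subst₂ _≤_
        (≡.sym (zeroExtend-inside q≤i (ℕ.<⇒≤ i<n)))
        (≡.sym (zeroExtend-inside (ℕ.m≤n⇒m≤1+n q≤i) i<n))
        (rise-to-mode modes i q≤i i<l)
        where
        i<n : i ℕ.< n
        i<n = ℕ.<-≤-trans i<l (ℕ.≤-trans l≤m m≤n)
      ... | inj₂ i<q = subst (_≤ zeroExtend K q n a (+ ℕ.suc i))
        (≡.sym (zeroExtend-outside λ (q≤i , _) → ℕ.<⇒≱ i<q q≤i))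
        (zeroExtend-nonNegative 0≤a (+ ℕ.suc i))

      -- From `i = n` on, the next term is 0, so nonnegativity again suffices.
      zeroExtend-fall : ∀ i → m ℕ.≤ i →
        zeroExtend K q n a (+ ℕ.suc i) ≤ zeroExtend K q n a (+ i)
      zeroExtend-fall i m≤i with ℕ.<-≤-connex i n
      ... | inj₁ i<n = subst₂ _≤_
        (≡.sym (zeroExtend-inside (ℕ.m≤n⇒m≤1+n q≤i) i<n))
        (≡.sym (zeroExtend-inside q≤i (ℕ.<⇒≤ i<n)))
        (fall-from-last-mode modes i m≤i i<n)
        where
        q≤i : q ℕ.≤ i
        q≤i = ℕ.≤-trans q≤l (ℕ.≤-trans l≤m m≤i)
      ... | inj₂ n≤i = subst (_≤ zeroExtend K q n a (+ i))
        (≡.sym (zeroExtend-outside λ (_ , i<n) → ℕ.<⇒≱ i<n n≤i))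
        (zeroExtend-nonNegative 0≤a (+ i))

      -- Successors in `i` and `r` cancel in `i ⊖ r`. The recursion ends either at `r = 0`, without
      -- a shift, or at `i = 0 < r`, where the left index is negative and its term is 0.
      shifted-rise : ∀ r i → i ℕ.< l ℕ.+ r →
        zeroExtend K q n a (i ⊖ r) ≤ zeroExtend K q n a (ℕ.suc i ⊖ r)
      shifted-rise ℕ.zero i i<l+0 =
        zeroExtend-rise i (subst (i ℕ.<_) (ℕ.+-identityʳ l) i<l+0)
      shifted-rise (ℕ.suc r) ℕ.zero _ = zeroExtend-nonNegative 0≤a (1 ⊖ ℕ.suc r)
      shifted-rise (ℕ.suc r) (ℕ.suc i) 1+i<l+1+r
        rewrite [1+m]⊖[1+n]≡m⊖n i r | [1+m]⊖[1+n]≡m⊖n (ℕ.suc i) r =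
        shifted-rise r i (ℕ.≤-pred (subst (ℕ.suc i ℕ.<_) (ℕ.+-suc l r) 1+i<l+1+r))

      shifted-fall : ∀ r i → m ℕ.+ r ℕ.≤ i →
        zeroExtend K q n a (ℕ.suc i ⊖ r) ≤ zeroExtend K q n a (i ⊖ r)
      shifted-fall ℕ.zero i m+0≤i =
        zeroExtend-fall i (subst (ℕ._≤ i) (ℕ.+-identityʳ m) m+0≤i)
      shifted-fall (ℕ.suc r) i m+1+r≤i
        -- The bound `suc (m + r) ≤ i` forces `i` to be a successor, so no negative index arises
        -- here.
        with i | subst (ℕ._≤ i) (ℕ.+-suc m r) m+1+r≤i
      ... | ℕ.suc j | ℕ.s≤s m+r≤j
        rewrite [1+m]⊖[1+n]≡m⊖n j r | [1+m]⊖[1+n]≡m⊖n (ℕ.suc j) r =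
        shifted-fall r j m+r≤j

theorem2p1 : ∀ {c ℓ₁ ℓ₂} (K : OrderedField c ℓ₁ ℓ₂) →
    let open OrderedField K in
    ∀ (q₁ n₁ q₂ n₂ : ℕ) → q₁ ℕ.≤ n₁ → q₂ ℕ.≤ n₂ →
    ∀ (x y : ℕ → Carrier) →
    NonNegative K q₁ n₁ x → NonNegative K q₂ n₂ y →
    ∀ (l₁ m₁ l₂ m₂ : ℕ) →
    HasModes K q₁ n₁ x l₁ m₁ → HasModes K q₂ n₂ y l₂ m₂ →
    ∀ (r₁ r₂ : ℕ) (a₁ a₂ : Carrier) → 0# < a₁ → 0# < a₂ →
    let z : ℕ → Carrier
        z i = a₁ * zeroExtend K q₁ n₁ x (i ⊖ r₁) + a₂ * zeroExtend K q₂ n₂ y (i ⊖ r₂)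
    in
    Unimodal K ((q₁ ℕ.+ r₁) ⊓ (q₂ ℕ.+ r₂)) ((n₁ ℕ.+ r₁) ⊔ (n₂ ℕ.+ r₂)) z
      ⇔
    Unimodal K ((l₁ ℕ.+ r₁) ⊓ (l₂ ℕ.+ r₂)) ((m₁ ℕ.+ r₁) ⊔ (m₂ ℕ.+ r₂)) z
theorem2p1 K q₁ n₁ q₂ n₂ _ _ x y 0≤x 0≤y l₁ m₁ l₂ m₂ modesˣ modesʸ r₁ r₂ a₁ a₂ 0<a₁ 0<a₂ =
  unimodal-⇔ K
    (ℕ.⊓-mono-≤ (ℕ.+-monoˡ-≤ r₁ X.q≤l) (ℕ.+-monoˡ-≤ r₂ Y.q≤l))
    -- The inner interval is nonempty because it contains the shifted modes of `x`.
    (ℕ.≤-trans (ℕ.m⊓n≤m _ _)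
      (ℕ.≤-trans (ℕ.+-monoˡ-≤ r₁ X.l≤m) (ℕ.m≤m⊔n _ _)))
    (ℕ.⊔-mono-≤ (ℕ.+-monoˡ-≤ r₁ X.m≤n) (ℕ.+-monoˡ-≤ r₂ Y.m≤n))
    -- An index below the minimum precedes the shifted modes of both sequences, so both summands
    -- rise; beyond the maximum both fall.
    (λ i _ i<l → +-mono-≤ K
      (*-monoʳ-≤ K 0<a₁ (shifted-rise K 0≤x modesˣ r₁ i (ℕ.<-≤-trans i<l (ℕ.m⊓n≤m _ _))))
      (*-monoʳ-≤ K 0<a₂ (shifted-rise K 0≤y modesʸ r₂ i (ℕ.<-≤-trans i<l (ℕ.m⊓n≤n (l₁ ℕ.+ r₁) _)))))
    (λ i m≤i _ → +-mono-≤ K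
      (*-monoʳ-≤ K 0<a₁ (shifted-fall K 0≤x modesˣ r₁ i (ℕ.≤-trans (ℕ.m≤m⊔n _ _) m≤i)))
      (*-monoʳ-≤ K 0<a₂ (shifted-fall K 0≤y modesʸ r₂ i (ℕ.≤-trans (ℕ.m≤n⊔m (m₁ ℕ.+ r₁) _) m≤i))))
  where
  module X = HasModes modesˣ
  module Y = HasModes modesʸ
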